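{- Max Proportionally Dense Subgraph is polynomial-time $\left(2-\frac{2}{\Delta+1}\right)$-approximable, where $\Delta$ is the maximum degree of the input graph. That is, there is a polynomial-time algorithm that, given a graph $G$ with maximum degree $\Delta$, returns a proportionally dense subgraph $G[S]$ with $\frac{opt(G)}{|S|}\le 2-\frac{2}{\Delta+1}$, where $opt(G)$ is the maximum size of a proportionally dense subgraph of $G$.
   Context: All graphs are finite, simple, undirected and connected. For a graph $G=(V,E)$, $d(v)$ is the degree of $v\in V$, $N(v)$ its set of neighbors, and for $S\subset V$, $d_S(v)=|N(v)\cap S|$, $\overline{S}=V\setminus S$, and $G[S]$ is the subgraph induced by $S$. For $S\subset V$ with $2\le |S|<|V|$, the induced subgraph $G[S]$ is a proportionally dense subgraph (PDS) if every $u\in S$ satisfies $\frac{d_S(u)}{|S|-1}\ge \frac{d(u)}{|V|-1}$ (equivalently $\frac{d_S(u)}{|S|-1}\ge\frac{d_{\overline{S}}(u)}{|\overline{S}|}$). Its size is $|S|$. A PDS is not required to be connected. (The definition presupposes $|V|\ge 3$ for a PDS to exist.) Max Proportionally Dense Subgraph: the input is a graph $G$; the output is a PDS of $G$ of maximum size. -}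

module Defs where

open import Data.Bool.Base using (Bool; true; false; T; if_then_else_)
open import Data.Fin.Base using (Fin; toℕ; fromℕ<; remQuot)
open import Data.Fin.Subset using (Subset; _∈_; _∩_; ∣_∣)
open import Data.Integer.Base using (+_)
open import Data.Nat.Base using (ℕ; suc; _+_; _*_; _∸_; _⊔_; _≤_; _<_; NonZero; >-nonZero; z≤n; s≤s)
open import Data.Nat.Properties using (_≟_; _<?_; ≤-trans; <-trans; m<n⇒0<n∸m)
open import Data.Product.Base using (_×_; ∃-syntax; uncurry)
open import Data.Rational.Unnormalised.Base using (ℚᵘ; _/_) renaming (_≤_ to _≤ℚ_)
open import Data.Vec.Base using (tabulate)
import Data.Vec.Functional as Vector
open import Relation.Binary.Construct.Closure.ReflexiveTransitive using (Star)
open import Relation.Binary.PropositionalEquality using (_≡_; _≢_)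
open import Relation.Nullary.Decidable using (does; yes; no)

record Graph (n : ℕ) : Set where
  field
    adj    : Fin n → Fin n → Bool
    symm   : ∀ u v → adj u v ≡ adj v u
    irrefl : ∀ v → adj v v ≡ false

open Graph public

module _ {n : ℕ} (G : Graph n) where

  Connected : Set
  Connected = ∀ u v → Star (λ x y → T (adj G x y)) u v

  N : Fin n → Subset n
  N v = tabulate (adj G v)

  degree : Fin n → ℕ
  degree v = ∣ N v ∣

  degreeIn : Subset n → Fin n → ℕ
  degreeIn S v = ∣ N v ∩ S ∣

  maxDegree : ℕ
  maxDegree = Vector.foldr _⊔_ 0 degree

  record IsPDS (S : Subset n) : Set where
    field
      2≤∣S∣ : 2 ≤ ∣ S ∣
      ∣S∣<n : ∣ S ∣ < n

    instance
      ∣S∣-nonZero : NonZero ∣ S ∣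
      ∣S∣-nonZero = >-nonZero (≤-trans (s≤s z≤n) 2≤∣S∣)

      ∣S∣∸1-nonZero : NonZero (∣ S ∣ ∸ 1)
      ∣S∣∸1-nonZero = >-nonZero (m<n⇒0<n∸m 2≤∣S∣)

      n∸1-nonZero : NonZero (n ∸ 1)
      n∸1-nonZero = >-nonZero (m<n⇒0<n∸m (<-trans 2≤∣S∣ ∣S∣<n))

    field
      dense : ∀ u → u ∈ S → (+ degree u) / (n ∸ 1) ≤ℚ (+ degreeIn S u) / (∣ S ∣ ∸ 1)

  IsOpt : ℕ → Set
  IsOpt m = (∃[ S ] IsPDS S × ∣ S ∣ ≡ m) × (∀ S → IsPDS S → ∣ S ∣ ≤ m)

performanceRatio : ∀ {n} {G : Graph n} {S : Subset n} → ℕ → IsPDS G S → ℚᵘ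
performanceRatio {S = S} opt pds = (+ opt / ∣ S ∣) {{IsPDS.∣S∣-nonZero pds}}

-- The model of computation is a structured random access machine: while
-- programs over natural-number variables and arrays, both named by naturals.
-- Time is uniform cost, counting every command executed and every expression
-- node evaluated.  Multiplication is deliberately not primitive: with only
-- + and ∸, uniform-cost time is polynomially equivalent to Turing machine time.

infixl 6 _⊕_ _⊖_
infix  4 _≔_ _⟦_⟧≔_
infixr 3 _⨾_

data Expr : Set where
  lit      : ℕ → Expr
  var      : ℕ → Expr
  _⟦_⟧     : ℕ → Expr → Expr
  _⊕_ _⊖_  : Expr → Expr → Expr

data Program : Set where
  skip          : Program
  _≔_           : ℕ → Expr → Program
  _⟦_⟧≔_        : ℕ → Expr → Expr → Program
  _⨾_           : Program → Program → Program
  If_Then_Else_ : Expr → Program → Program → Program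
  While_Do_     : Expr → Program → Program

record State : Set where
  constructor ⟪_,_⟫
  field
    variables : ℕ → ℕ
    arrays    : ℕ → ℕ → ℕ

open State public

_[_↦_] : {A : Set} → (ℕ → A) → ℕ → A → (ℕ → A)
(f [ x ↦ a ]) y = if does (y ≟ x) then a else f y

eval : Expr → State → ℕ
eval (lit k)   σ = k
eval (var x)   σ = variables σ x
eval (a ⟦ e ⟧) σ = arrays σ a (eval e σ)
eval (e ⊕ f)   σ = eval e σ + eval f σ
eval (e ⊖ f)   σ = eval e σ ∸ eval f σ

cost : Expr → ℕ
cost (lit k)   = 1
cost (var x)   = 1
cost (a ⟦ e ⟧) = suc (cost e)
cost (e ⊕ f)   = suc (cost e + cost f)
cost (e ⊖ f)   = suc (cost e + cost f)

setVar : ℕ → ℕ → State → State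
setVar x k σ = ⟪ variables σ [ x ↦ k ] , arrays σ ⟫

setCell : ℕ → ℕ → ℕ → State → State
setCell a i k σ = ⟪ variables σ , arrays σ [ a ↦ arrays σ a [ i ↦ k ] ] ⟫

-- ⟨ p , σ ⟩⇓⟨ τ , t ⟩: started in σ, the program p halts in τ after t steps.
-- Guards hold when nonzero.
data ⟨_,_⟩⇓⟨_,_⟩ : Program → State → State → ℕ → Set where
  skip⇓ : ∀ {σ} → ⟨ skip , σ ⟩⇓⟨ σ , 1 ⟩
  var⇓ : ∀ {σ x e} →
    ⟨ x ≔ e , σ ⟩⇓⟨ setVar x (eval e σ) σ , suc (cost e) ⟩
  cell⇓ : ∀ {σ a i e} →
    ⟨ a ⟦ i ⟧≔ e , σ ⟩⇓⟨ setCell a (eval i σ) (eval e σ) σ , suc (cost i + cost e) ⟩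
  seq⇓ : ∀ {σ τ υ p q s t} →
    ⟨ p , σ ⟩⇓⟨ τ , s ⟩ → ⟨ q , τ ⟩⇓⟨ υ , t ⟩ →
    ⟨ p ⨾ q , σ ⟩⇓⟨ υ , suc (s + t) ⟩
  then⇓ : ∀ {σ τ e p q t} → eval e σ ≢ 0 → ⟨ p , σ ⟩⇓⟨ τ , t ⟩ →
    ⟨ If e Then p Else q , σ ⟩⇓⟨ τ , suc (cost e + t) ⟩
  else⇓ : ∀ {σ τ e p q t} → eval e σ ≡ 0 → ⟨ q , σ ⟩⇓⟨ τ , t ⟩ →
    ⟨ If e Then p Else q , σ ⟩⇓⟨ τ , suc (cost e + t) ⟩
  exit⇓ : ∀ {σ e p} → eval e σ ≡ 0 →
    ⟨ While e Do p , σ ⟩⇓⟨ σ , suc (cost e) ⟩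
  loop⇓ : ∀ {σ τ υ e p s t} → eval e σ ≢ 0 →
    ⟨ p , σ ⟩⇓⟨ τ , s ⟩ → ⟨ While e Do p , τ ⟩⇓⟨ υ , t ⟩ →
    ⟨ While e Do p , σ ⟩⇓⟨ υ , suc (cost e + (s + t)) ⟩

-- Row-major: the entry for (u , v) is at index toℕ u * n + toℕ v.
adjacencyArray : ∀ {n} → Graph n → ℕ → ℕ
adjacencyArray {n} G i with i <? n * n
... | yes i<n² = if uncurry (adj G) (remQuot n (fromℕ< i<n²)) then 1 else 0
... | no  _    = 0

-- Input: the number of vertices in variable 0 and the adjacency matrix in
-- array 0, everything else being zero.
input : ∀ {n} → Graph n → State
input {n} G = ⟪ (λ _ → 0) [ 0 ↦ n ] , (λ _ _ → 0) [ 0 ↦ adjacencyArray G ] ⟫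

-- Output: the set of vertices whose entry in array 1 is nonzero.
output : ∀ n → State → Subset n
output n σ = tabulate (λ v → does (0 <? arrays σ 1 (toℕ v)))

{-# OPTIONS --safe #-}
module Submission where

-- Local search on sets S with n ≤ 2|S| ≤ n + 2: as long as some u in S makes it
-- profitable, replace S by (V ∖ S) ∪ {u}, which again lies in this range.  Profitable
-- means that the potential 2 cut(S) + |S| drops; it is at most n² + n, so
-- polynomially many exchanges happen.  If no exchange is profitable then every
-- u in S satisfies 2 d_S̄(u) + 2|S| ≤ 2 d_S(u) + n + 1, and on each of the three possible
-- sizes this implies the density condition.
--
-- Conversely a PDS S has, by connectedness, a vertex x with d_S(x) ≤ d(x) − 1, and
-- density at x gives |S| (d(x) + 1) ≤ n d(x), hence opt (Δ + 1) ≤ n Δ ≤ 2 |S| Δ for the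
-- set S found by the search.

open import Defs
open import Algebra.Properties.CommutativeMonoid.Sum using (sum; sum-cong-≗; sum-remove; ∑-distrib-+)
open import Data.Bool.Base using (Bool; true; false; T; if_then_else_; not; _∧_; _xor_)
open import Data.Bool.Properties using (T-≡; xor-annihilates-not; xor-comm; not-involutive)
open import Data.Fin.Base using (Fin; zero; suc; toℕ; fromℕ<; combine; remQuot; punchIn)
open import Data.Fin.Properties as Fin using (toℕ<n; toℕ-injective; toℕ-fromℕ<; toℕ-combine; remQuot-combine; punchInᵢ≢i)
open import Data.Fin.Subset using (Subset; ∣_∣; _∩_; _∈_; _∉_; Nonempty; ⊤)
open import Data.Fin.Subset.Properties using (_∈?_; anySubset?; nonempty?; Empty-unique; ∣⊥∣≡0; ∣⊤∣≡n; ∣p∣≤n; ⊆⊤; ∈⊤; p⊆q⇒∣p∣≤∣q∣; p⊂q⇒∣p∣<∣q∣; p∩q⊆p; p∩q⊆q)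
open import Data.Integer.Base as ℤ using (+_; -[1+_])
import Data.Integer.Properties as ℤ
open import Data.Nat.Base using (ℕ; zero; suc; _+_; _*_; _∸_; _⊔_; _^_; _≤_; _<_; _<ᵇ_; NonZero; >-nonZero; z≤n; s≤s; s≤s⁻¹)
open import Data.Nat.Properties
open import Data.Nat.Tactic.RingSolver using (solve-∀)
open import Data.Product.Base using (Σ; _×_; _,_; ∃-syntax; Σ-syntax; proj₁; proj₂)
open import Data.Rational.Unnormalised.Base using (*≤*; _/_; _-_) renaming (_≤_ to _≤ℚ_)
open import Data.Rational.Unnormalised.Properties using (drop-*≤*)
open import Data.Sum.Base using (_⊎_; inj₁; inj₂)
open import Data.Vec.Base using (tabulate)
import Data.Vec.Functional as Vector
open import Data.Vec.Properties using ([]=⇒lookup; lookup⇒[]=; lookup∘tabulate; tabulate-cong)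
open import Function.Base using (_∘_; _$_; _∋_)
open import Function.Bundles using (Equivalence)
open import Level using (0ℓ)
open import Relation.Binary.Construct.Closure.ReflexiveTransitive using (Star; ε; _◅_)
open import Relation.Binary.PropositionalEquality using (_≡_; _≢_; refl; sym; trans; cong; cong₂; subst; subst₂; module ≡-Reasoning)
open import Relation.Nullary using (¬_; yes; no; does; contradiction; ¬?; _×-dec_; _→-dec_)
open import Relation.Nullary.Decidable using (dec-true; dec-false; map′)
open import Relation.Unary using (Pred; Decidable)

-- Finite sums and symmetric double sums

∑ : ∀ {n} → (Fin n → ℕ) → ℕ
∑ = sum +-0-commutativeMonoid

∑-cong : ∀ {n} {f g : Fin n → ℕ} → (∀ i → f i ≡ g i) → ∑ f ≡ ∑ g
∑-cong = sum-cong-≗ +-0-commutativeMonoid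

∑-+ : ∀ {n} (f g : Fin n → ℕ) → ∑ (λ i → f i + g i) ≡ ∑ f + ∑ g
∑-+ = ∑-distrib-+ +-0-commutativeMonoid

∑-split : ∀ {n} (i : Fin (suc n)) f → ∑ f ≡ f i + ∑ (f ∘ punchIn i)
∑-split i f = sum-remove +-0-commutativeMonoid {i = i} f

∑-mono : ∀ {n} {f g : Fin n → ℕ} → (∀ i → f i ≤ g i) → ∑ f ≤ ∑ g
∑-mono {zero}  f≤g = z≤n
∑-mono {suc n} f≤g = +-mono-≤ (f≤g zero) (∑-mono (f≤g ∘ suc))

∑-bounded : ∀ {n c} {f : Fin n → ℕ} → (∀ i → f i ≤ c) → ∑ f ≤ n * c
∑-bounded {zero}  f≤c = z≤n
∑-bounded {suc n} f≤c = +-mono-≤ (f≤c zero) (∑-bounded (f≤c ∘ suc))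

∑∑ : ∀ {n} → (Fin n → Fin n → ℕ) → ℕ
∑∑ f = ∑ (λ x → ∑ (f x))

-- By symmetry column `u` has the same sum as row `u`, and the corner they share is zero, so
-- removing both counts nothing twice.
∑∑-split : ∀ {n} (u : Fin (suc n)) f → (∀ x y → f x y ≡ f y x) → f u u ≡ 0 →
  ∑∑ f ≡ ∑ (f u) + ∑ (f u) + ∑∑ (λ x y → f (punchIn u x) (punchIn u y))
∑∑-split u f f-sym f-diag = begin
  ∑∑ f                                              ≡⟨ ∑-split u (λ x → ∑ (f x)) ⟩
  row + ∑ (λ x → ∑ (f (p x)))                       ≡⟨ cong (_+_ row) (∑-cong (λ x → ∑-split u (f (p x)))) ⟩
  row + ∑ (λ x → f (p x) u + ∑ (λ y → f (p x) (p y))) ≡⟨ cong (_+_ row) (∑-+ (λ x → f (p x) u) _) ⟩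
  row + (∑ (λ x → f (p x) u) + rest)                ≡⟨ cong (λ c → row + (c + rest)) column ⟩
  row + (row + rest)                                ≡⟨ +-assoc row row rest ⟨
  row + row + rest                                  ∎
  where
  open ≡-Reasoning
  p = punchIn u
  row = ∑ (f u)
  rest = ∑∑ (λ x y → f (p x) (p y))
  column : ∑ (λ x → f (p x) u) ≡ row
  column = begin
    ∑ (λ x → f (p x) u)          ≡⟨ ∑-cong (λ x → f-sym (p x) u) ⟩
    ∑ (f u ∘ p)                  ≡⟨ cong (_+ ∑ (f u ∘ p)) f-diag ⟨
    f u u + ∑ (f u ∘ p)          ≡⟨ ∑-split u (f u) ⟨
    row                          ∎

-- The two matrices differ only in row and column `u`, so what remains after `∑∑-split` cancels.
-- Each total is paired with the other matrix's row, which avoids subtraction on ℕ. It is applied to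
-- the crossing edges before and after an exchange.
∑∑-change : ∀ {n} (u : Fin n) {f g : Fin n → Fin n → ℕ} →
  (∀ x y → f x y ≡ f y x) → (∀ x y → g x y ≡ g y x) → f u u ≡ 0 → g u u ≡ 0 →
  (∀ x y → x ≢ u → y ≢ u → f x y ≡ g x y) →
  ∑∑ g + (∑ (f u) + ∑ (f u)) ≡ ∑∑ f + (∑ (g u) + ∑ (g u))
∑∑-change {suc n} u {f} {g} f-sym g-sym f-diag g-diag f≡g = begin
  ∑∑ g + (F + F)          ≡⟨ cong (_+ (F + F)) (∑∑-split u g g-sym g-diag) ⟩
  K + K + rest g + (F + F)  ≡⟨ cong (λ r → K + K + r + (F + F)) (sym rest≡) ⟩
  K + K + rest f + (F + F)  ≡⟨ swap K F (rest f) ⟩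
  F + F + rest f + (K + K)  ≡⟨ cong (_+ (K + K)) (∑∑-split u f f-sym f-diag) ⟨
  ∑∑ f + (K + K)          ∎
  where
  open ≡-Reasoning
  F = ∑ (f u)
  K = ∑ (g u)
  rest : (Fin (suc n) → Fin (suc n) → ℕ) → ℕ
  rest h = ∑∑ (λ x y → h (punchIn u x) (punchIn u y))
  rest≡ : rest f ≡ rest g
  rest≡ = ∑-cong λ x → ∑-cong λ y → f≡g _ _ (punchInᵢ≢i u x) (punchInᵢ≢i u y)
  swap : ∀ a b c → a + a + c + (b + b) ≡ b + b + c + (a + a)
  swap = solve-∀

-- Cardinalities as sums of bits, cut and potential

bit : Bool → ℕ
bit b = if b then 1 else 0

bit≤1 : ∀ b → bit b ≤ 1
bit≤1 true  = s≤s z≤n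
bit≤1 false = z≤n

∣tabulate∣ : ∀ {n} (S : Fin n → Bool) → ∣ tabulate S ∣ ≡ ∑ (bit ∘ S)
∣tabulate∣ {zero}  S = refl
∣tabulate∣ {suc n} S with S zero
... | true  = cong suc (∣tabulate∣ (S ∘ suc))
... | false = ∣tabulate∣ (S ∘ suc)

∣tabulate∩tabulate∣ : ∀ {n} (R S : Fin n → Bool) →
  ∣ tabulate R ∩ tabulate S ∣ ≡ ∑ (λ v → bit (R v ∧ S v))
∣tabulate∩tabulate∣ {zero}  R S = refl
∣tabulate∩tabulate∣ {suc n} R S with R zero ∧ S zero
... | true  = cong suc (∣tabulate∩tabulate∣ (R ∘ suc) (S ∘ suc))
... | false = ∣tabulate∩tabulate∣ (R ∘ suc) (S ∘ suc)

size : ∀ {n} → (Fin n → Bool) → ℕ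
size S = ∑ (bit ∘ S)

-- The lower bound yields the approximation ratio. The upper bound is its mirror image under `s` to
-- `n + 1 - s`, the effect of an exchange on the size, so that the range is preserved.
Balanced : ∀ {n} → (Fin n → Bool) → Set
Balanced {n} S = n ≤ size S + size S × size S + size S ≤ suc (suc n)

module _ {n} (G : Graph n) (S : Fin n → Bool) where

  inner outer : Fin n → ℕ
  inner v = ∑ (λ w → bit (adj G v w ∧ S w))
  outer v = ∑ (λ w → bit (adj G v w ∧ not (S w)))

  -- Every cut edge is counted twice, once in each direction.
  cut : ℕ
  cut = ∑∑ (λ v w → bit (adj G v w ∧ (S v xor S w)))

  potential : ℕ
  potential = cut + size S

  -- For v in S, equivalent to potential (exchange S v) < potential S.
  Improvable : Fin n → Set
  Improvable v = suc n + (inner v + inner v) < (size S + size S) + (outer v + outer v)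

  degree≡inner+outer : ∀ v → degree G v ≡ inner v + outer v
  degree≡inner+outer v = begin
    degree G v  ≡⟨ ∣tabulate∣ (adj G v) ⟩
    ∑ (λ w → bit (adj G v w)) ≡⟨ ∑-cong (λ w → split (adj G v w) (S w)) ⟩
    ∑ (λ w → bit (adj G v w ∧ S w) + bit (adj G v w ∧ not (S w))) ≡⟨ ∑-+ (λ w → bit (adj G v w ∧ S w)) _ ⟩
    inner v + outer v ∎
    where
    open ≡-Reasoning
    split : ∀ a s → bit a ≡ bit (a ∧ s) + bit (a ∧ not s)
    split false s     = refl
    split true  true  = refl
    split true  false = refl

  -- The neighbours counted by `outer` lie outside `S`, so every vertex contributes at most once.
  outer+size≤n : ∀ v → outer v + size S ≤ n
  outer+size≤n v = begin
    outer v + size S ≡⟨ ∑-+ (λ w → bit (adj G v w ∧ not (S w))) _ ⟨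
    ∑ (λ w → bit (adj G v w ∧ not (S w)) + bit (S w)) ≤⟨ ∑-bounded (λ w → ≤1 (adj G v w) (S w)) ⟩
    n * 1 ≡⟨ *-identityʳ n ⟩
    n ∎
    where
    open ≤-Reasoning
    ≤1 : ∀ a s → bit (a ∧ not s) + bit s ≤ 1
    ≤1 true  true  = s≤s z≤n
    ≤1 true  false = s≤s z≤n
    ≤1 false s     = bit≤1 s

  size≤n : size S ≤ n
  size≤n = ≤-trans (∑-bounded (λ v → bit≤1 (S v))) (≤-reflexive (*-identityʳ n))

  potential≤ : potential ≤ n * n + n
  potential≤ = +-mono-≤
    (∑-bounded {n} {n} λ v → ≤-trans
      (∑-bounded {n} {1} λ w → bit≤1 (adj G v w ∧ (S v xor S w)))
      (≤-reflexive (*-identityʳ n)))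
    size≤n

-- The exchange and its effect on size, cut and potential

exchange : ∀ {n} → (Fin n → Bool) → Fin n → (Fin n → Bool)
exchange S u v = if does (v Fin.≟ u) then true else not (S v)

exchange-≡ : ∀ {n} (S : Fin n → Bool) u → exchange S u u ≡ true
exchange-≡ S u with u Fin.≟ u
... | yes _  = refl
... | no u≢u = contradiction refl u≢u

exchange-≢ : ∀ {n} (S : Fin n → Bool) {u v} → v ≢ u → exchange S u v ≡ not (S v)
exchange-≢ S {u} {v} v≢u with v Fin.≟ u
... | yes v≡u = contradiction v≡u v≢u
... | no _    = refl

bit+bit-not : ∀ b → bit (not b) + bit b ≡ 1
bit+bit-not true  = refl
bit+bit-not false = refl

∑-ones : ∀ n → ∑ {n} (λ _ → 1) ≡ n
∑-ones zero    = refl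
∑-ones (suc n) = cong suc (∑-ones n)

-- Each vertex lies in exactly one of the two sets, except `u`, which lies in both.
size-exchange : ∀ {n} (S : Fin n → Bool) u → S u ≡ true → size (exchange S u) + size S ≡ suc n
size-exchange {suc n} S u u∈S = begin
  size (exchange S u) + size S                      ≡⟨ ∑-+ (bit ∘ exchange S u) (bit ∘ S) ⟨
  ∑ (λ v → bit (exchange S u v) + bit (S v))        ≡⟨ ∑-split u (λ v → bit (exchange S u v) + bit (S v)) ⟩
  bit (exchange S u u) + bit (S u) + ∑ (λ v → bit (exchange S u (p v)) + bit (S (p v)))
    ≡⟨ cong₂ (λ a b → bit a + bit b + ∑ (λ v → bit (exchange S u (p v)) + bit (S (p v)))) (exchange-≡ S u) u∈S ⟩
  2 + ∑ (λ v → bit (exchange S u (p v)) + bit (S (p v)))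
    ≡⟨ cong (_+_ 2) (∑-cong λ v → trans
         (cong (λ b → bit b + bit (S (p v))) (exchange-≢ S (punchInᵢ≢i u v)))
         (bit+bit-not (S (p v)))) ⟩
  2 + ∑ {n} (λ _ → 1)                           ≡⟨ cong (_+_ 2) (∑-ones n) ⟩
  suc (suc n)                                   ∎
  where
  open ≡-Reasoning
  p = punchIn u

-- Doubling `size-exchange` gives `2 s′ + 2 s = 2 n + 2`, so the bounds `n` and `n + 2` trade
-- places.
balanced-exchange : ∀ {n} (S : Fin n → Bool) u → S u ≡ true → Balanced S → Balanced (exchange S u)
balanced-exchange {n} S u u∈S (lower , upper) =
    +-cancelʳ-≤ (suc (suc n)) n (s′ + s′) (begin
      n + suc (suc n) ≡⟨ +-suc n (suc n) ⟩
      suc n + suc n ≡⟨ doubled ⟨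
      s′ + s′ + (s + s) ≤⟨ +-monoʳ-≤ (s′ + s′) upper ⟩
      s′ + s′ + suc (suc n) ∎)
  , +-cancelʳ-≤ n (s′ + s′) (suc (suc n)) (begin
      s′ + s′ + n ≤⟨ +-monoʳ-≤ (s′ + s′) lower ⟩
      s′ + s′ + (s + s) ≡⟨ doubled ⟩
      suc n + suc n ≡⟨ cong suc (+-suc n n) ⟩
      suc (suc n) + n ∎)
  where
  open ≤-Reasoning
  s = size S
  s′ = size (exchange S u)
  rearrange : ∀ a b → a + a + (b + b) ≡ (a + b) + (a + b)
  rearrange = solve-∀
  doubled : s′ + s′ + (s + s) ≡ suc n + suc n
  doubled = trans (rearrange s′ s) (cong₂ _+_ (size-exchange S u u∈S) (size-exchange S u u∈S))

module _ {n} (G : Graph n) (S : Fin n → Bool) (u : Fin n) (u∈S : S u ≡ true) where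

  private
    crossing : (Fin n → Bool) → Fin n → Fin n → ℕ
    crossing R v w = bit (adj G v w ∧ (R v xor R w))

    crossing-sym : ∀ R v w → crossing R v w ≡ crossing R w v
    crossing-sym R v w = cong₂ (λ a b → bit (a ∧ b)) (symm G v w) (xor-comm (R v) (R w))

    crossing-diag : ∀ R v → crossing R v v ≡ 0
    crossing-diag R v = cong (λ a → bit (a ∧ (R v xor R v))) (irrefl G v)

    row-S : ∑ (crossing S u) ≡ outer G S u
    row-S = ∑-cong λ w → cong (λ b → bit (adj G u w ∧ (b xor S w))) u∈S

    row-exchange : ∑ (crossing (exchange S u) u) ≡ inner G S u
    row-exchange = ∑-cong entry
      where
      entry : ∀ w → crossing (exchange S u) u w ≡ bit (adj G u w ∧ S w)
      entry w with w Fin.≟ u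
      -- At `u` itself the exchange does not negate membership, but there is no loop to count.
      ... | yes refl rewrite irrefl G u = refl
      ... | no w≢u = cong (λ b → bit (adj G u w ∧ b))
        (trans (cong (_xor not (S w)) (exchange-≡ S u)) (not-involutive (S w)))

  -- Complementing both ends of an edge does not change whether it crosses, so only edges at `u`
  -- matter: `u` keeps its side while all its neighbours switch, hence its outer edges leave the cut
  -- and its inner edges enter it, each counted twice.
  cut-exchange : cut G (exchange S u) + (outer G S u + outer G S u) ≡ cut G S + (inner G S u + inner G S u)
  cut-exchange = begin
    cut G (exchange S u) + (outer G S u + outer G S u)
      ≡⟨ cong (λ r → cut G (exchange S u) + (r + r)) row-S ⟨
    cut G (exchange S u) + (∑ (crossing S u) + ∑ (crossing S u))
      ≡⟨ ∑∑-change u (crossing-sym S) (crossing-sym (exchange S u))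
           (crossing-diag S u) (crossing-diag (exchange S u) u) off ⟩
    cut G S + (∑ (crossing (exchange S u) u) + ∑ (crossing (exchange S u) u))
      ≡⟨ cong (λ r → cut G S + (r + r)) row-exchange ⟩
    cut G S + (inner G S u + inner G S u) ∎
    where
    open ≡-Reasoning
    off : ∀ x y → x ≢ u → y ≢ u → crossing S x y ≡ crossing (exchange S u) x y
    off x y x≢u y≢u = cong (λ b → bit (adj G x y ∧ b)) (sym (trans
      (cong₂ _xor_ (exchange-≢ S x≢u) (exchange-≢ S y≢u)) (xor-annihilates-not (S x) (S y))))

  -- After adding `o + o + s` to both sides, the cut and size equations turn the claim into
  -- `Improvable` shifted by `cut G S`.
  potential-exchange : Improvable G S u → potential G (exchange S u) < potential G S
  potential-exchange improvable = +-cancelʳ-< (o + o + s) (potential G (exchange S u)) (potential G S) (begin-strict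
    cut G (exchange S u) + s′ + (o + o + s) ≡⟨ rearrange₁ (cut G (exchange S u)) s′ (o + o) s ⟩
    (cut G (exchange S u) + (o + o)) + (s′ + s) ≡⟨ cong₂ _+_ cut-exchange (size-exchange S u u∈S) ⟩
    (cut G S + (i + i)) + suc n ≡⟨ rearrange₂ (cut G S) (i + i) (suc n) ⟩
    cut G S + (suc n + (i + i)) <⟨ +-monoʳ-< (cut G S) improvable ⟩
    cut G S + (s + s + (o + o)) ≡⟨ rearrange₃ (cut G S) s (o + o) ⟩
    cut G S + s + (o + o + s) ∎)
    where
    open ≤-Reasoning
    s = size S
    s′ = size (exchange S u)
    o = outer G S u
    i = inner G S u
    rearrange₁ : ∀ c s′ o s → c + s′ + (o + s) ≡ (c + o) + (s′ + s)
    rearrange₁ = solve-∀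
    rearrange₂ : ∀ c i m → (c + i) + m ≡ c + (m + i)
    rearrange₂ = solve-∀
    rearrange₃ : ∀ c s o → c + (s + s + o) ≡ c + s + (o + s)
    rearrange₃ = solve-∀

-- Proportional density as a decidable inequality between naturals

∈-tabulate⁻ : ∀ {n} {S : Fin n → Bool} {u} → u ∈ tabulate S → S u ≡ true
∈-tabulate⁻ {S = S} {u} u∈S = trans (sym (lookup∘tabulate S u)) ([]=⇒lookup u∈S)

∈-tabulate⁺ : ∀ {n} {S : Fin n → Bool} {u} → S u ≡ true → u ∈ tabulate S
∈-tabulate⁺ {S = S} {u} Su = lookup⇒[]= u (tabulate S) (trans (lookup∘tabulate S u) Su)

/-≤⁺ : ∀ a b d e .{{_ : NonZero d}} .{{_ : NonZero e}} → a * e ≤ b * d → (+ a / d) ≤ℚ (+ b / e)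
/-≤⁺ a b (suc d) (suc e) ae≤bd = *≤* (subst₂ ℤ._≤_ (ℤ.pos-* a (suc e)) (ℤ.pos-* b (suc d)) (ℤ.+≤+ ae≤bd))

/-≤⁻ : ∀ a b d e .{{_ : NonZero d}} .{{_ : NonZero e}} → (+ a / d) ≤ℚ (+ b / e) → a * e ≤ b * d
/-≤⁻ a b (suc d) (suc e) p≤q =
  ℤ.drop‿+≤+ (subst₂ ℤ._≤_ (sym (ℤ.pos-* a (suc e))) (sym (ℤ.pos-* b (suc d))) (drop-*≤* p≤q))

module _ {n} {G : Graph n} where

  isPDS : ∀ S → 2 ≤ ∣ S ∣ → ∣ S ∣ < n →
    (∀ u → u ∈ S → degree G u * (∣ S ∣ ∸ 1) ≤ degreeIn G S u * (n ∸ 1)) → IsPDS G S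
  isPDS S 2≤∣S∣ ∣S∣<n dense = record
    { 2≤∣S∣ = 2≤∣S∣
    ; ∣S∣<n = ∣S∣<n
    ; dense = λ u u∈S → /-≤⁺ (degree G u) (degreeIn G S u) (n ∸ 1) (∣ S ∣ ∸ 1) {{_}} {{_}} (dense u u∈S)
    }

  IsPDS⇒dense : ∀ {S} → IsPDS G S → ∀ u → u ∈ S → degree G u * (∣ S ∣ ∸ 1) ≤ degreeIn G S u * (n ∸ 1)
  IsPDS⇒dense {S} pds u u∈S = /-≤⁻ (degree G u) (degreeIn G S u) (n ∸ 1) (∣ S ∣ ∸ 1)
    {{IsPDS.n∸1-nonZero pds}} {{IsPDS.∣S∣∸1-nonZero pds}} (IsPDS.dense pds u u∈S)

  isPDS? : Decidable (IsPDS G)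
  isPDS? S = map′ (λ (p , q , r) → isPDS S p q r)
    (λ pds → IsPDS.2≤∣S∣ pds , IsPDS.∣S∣<n pds , IsPDS⇒dense pds)
    ((2 ≤? ∣ S ∣) ×-dec (∣ S ∣ <? n) ×-dec
      Fin.all? (λ u → (u ∈? S) →-dec (degree G u * (∣ S ∣ ∸ 1) ≤? degreeIn G S u * (n ∸ 1))))

-- Density of sets without an improvable vertex

m+m≤1+n+n⇒m≤n : ∀ {m n} → m + m ≤ suc (n + n) → m ≤ n
m+m≤1+n+n⇒m≤n {m} {n} m+m≤ = ≮⇒≥ λ n<m → <⇒≱
  (≤-trans (s≤s (≤-reflexive (sym (+-suc n n)))) (+-mono-≤ n<m n<m))
  m+m≤

-- Here `m` is the size of the complement, `suc s` that of the set, and `i`, `o` are the inner and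
-- outer degrees of a vertex. The conclusion is density in its second form, comparing `i / s` with
-- `o / m`, cross-multiplied. The range leaves `s` among `m - 1`, `m` and `m + 1`.
not-improvable⇒dense : ∀ {m s i o} → m ≤ suc s → suc s ≤ suc (suc m) → o ≤ m →
  suc s + (o + o) ≤ suc m + (i + i) → o * s ≤ i * m
not-improvable⇒dense {m} {s} {i} {o} m≤1+s s≤1+m o≤m stuck with s ≤? m
-- For the two smaller sizes, being stuck gives `2 o ≤ 2 i + 1`, and parity improves this to
-- `o ≤ i`.
... | yes s≤m = *-mono-≤ {o} {i} (m+m≤1+n+n⇒m≤n (+-cancelˡ-≤ (suc s) (o + o) _ (begin
  suc s + (o + o)       ≤⟨ stuck ⟩
  suc m + (i + i)       ≤⟨ +-monoˡ-≤ (i + i) (s≤s m≤1+s) ⟩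
  suc (suc s) + (i + i) ≡⟨ +-suc (suc s) (i + i) ⟨
  suc s + suc (i + i)   ∎))) s≤m
  where open ≤-Reasoning
-- Now `s = m + 1`. Being stuck gives `2 o + 1 ≤ 2 i`, hence `o < i`; the spare copy of `m` pays for
-- the extra `o`.
... | no s≰m with refl ← ≤-antisym (s≤s⁻¹ s≤1+m) (≰⇒> s≰m) = begin
  o * suc m    ≡⟨ *-suc o m ⟩
  o + o * m    ≤⟨ +-monoˡ-≤ (o * m) o≤m ⟩
  suc o * m    ≤⟨ *-monoˡ-≤ m o<i ⟩
  i * m        ∎
  where
  open ≤-Reasoning
  o<i : o < i
  o<i = m+m≤1+n+n⇒m≤n (begin
    suc o + suc o     ≡⟨ cong suc (+-suc o o) ⟩
    suc (suc (o + o)) ≤⟨ s≤s (+-cancelˡ-≤ (suc m) _ _ (≤-trans (≤-reflexive (+-suc (suc m) (o + o))) stuck)) ⟩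
    suc (i + i)       ∎)

module _ {n} {G : Graph n} {S : Fin n → Bool} (3≤n : 3 ≤ n) (balanced : Balanced S) where

  private
    s = size S
    lower = proj₁ balanced
    upper = proj₂ balanced

    -- If `s ≤ 1`, then `n ≤ 2 s ≤ 2`. For the next bound, `n ≤ s` would give `2 n ≤ n + 2`. Both
    -- contradict `3 ≤ n`.
    2≤s : 2 ≤ s
    2≤s = ≮⇒≥ λ s<2 → <⇒≱ 3≤n (≤-trans lower (+-mono-≤ (s≤s⁻¹ s<2) (s≤s⁻¹ s<2)))

    s<n : s < n
    s<n = ≰⇒> λ n≤s → <⇒≱ 3≤n (+-cancelʳ-≤ n n 2 (≤-trans (+-mono-≤ n≤s n≤s) upper))

  stuck⇒IsPDS : (∀ u → S u ≡ true → ¬ Improvable G S u) → IsPDS G (tabulate S)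
  stuck⇒IsPDS stuck = isPDS (tabulate S)
    (subst (2 ≤_) (sym (∣tabulate∣ S)) 2≤s) (subst (_< n) (sym (∣tabulate∣ S)) s<n) dense
    where
    -- Writing `n = s + m` and `s = suc s′` makes `n ∸ 1` equal to `s′ + m`, so `i * s′` splits off
    -- on both sides and `o * s′ ≤ i * m` remains.
    arith : ∀ {n s} i o → 2 ≤ s → s < n → n ≤ s + s → s + s ≤ suc (suc n) → o + s ≤ n →
      s + s + (o + o) ≤ suc n + (i + i) → (i + o) * (s ∸ 1) ≤ i * (n ∸ 1)
    arith {n} {s} i o 2≤s s<n lower upper o+s≤n stuck with m , refl ← m≤n⇒∃[o]m+o≡n (<⇒≤ s<n) | s
    ... | suc s′ = begin
      (i + o) * s′      ≡⟨ *-distribʳ-+ s′ i o ⟩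
      i * s′ + o * s′   ≤⟨ +-monoʳ-≤ (i * s′) (not-improvable⇒dense {i = i} {o = o}
                             (+-cancelˡ-≤ (suc s′) m (suc s′) lower)
                             (+-cancelˡ-≤ (suc s′) (suc s′) _ (≤-trans upper (≤-reflexive (shift (suc s′) m))))
                             (+-cancelʳ-≤ (suc s′) o m (≤-trans o+s≤n (≤-reflexive (+-comm (suc s′) m))))
                             (+-cancelˡ-≤ (suc s′) _ _ (≤-trans (≤-reflexive (sym (+-assoc (suc s′) (suc s′) (o + o))))
                               (≤-trans stuck (≤-reflexive (shift′ (suc s′) m (i + i))))))) ⟩
      i * s′ + i * m    ≡⟨ *-distribˡ-+ i s′ m ⟨
      i * (s′ + m)      ∎
      where
      open ≤-Reasoning
      shift : ∀ s m → suc (suc (s + m)) ≡ s + suc (suc m)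
      shift = solve-∀
      shift′ : ∀ s m i → suc (s + m) + i ≡ s + (suc m + i)
      shift′ = solve-∀

    dense : ∀ u → u ∈ tabulate S →
      degree G u * (∣ tabulate S ∣ ∸ 1) ≤ degreeIn G (tabulate S) u * (n ∸ 1)
    dense u u∈S
      rewrite degree≡inner+outer G S u | ∣tabulate∣ S | ∣tabulate∩tabulate∣ (adj G u) S
      = arith (inner G S u) (outer G S u) 2≤s s<n lower upper (outer+size≤n G S u)
          (≮⇒≥ (stuck u (∈-tabulate⁻ u∈S)))

-- Existence of the optimum and an upper bound for it

maximum-size : ∀ {n} {P : Pred (Subset n) 0ℓ} → Decidable P → ∃[ S ] P S →
  ∃[ m ] (∃[ S ] P S × ∣ S ∣ ≡ m) × (∀ S → P S → ∣ S ∣ ≤ m)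
maximum-size {n} {P} P? (S₀ , PS₀) = descend n (λ S _ → ∣p∣≤n S)
  where
  -- The bound `k` starts at `n` and is lowered as long as no set in `P` attains it; at 0 it is
  -- attained by `S₀`.
  descend : ∀ k → (∀ S → P S → ∣ S ∣ ≤ k) →
    ∃[ m ] (∃[ S ] P S × ∣ S ∣ ≡ m) × (∀ S → P S → ∣ S ∣ ≤ m)
  descend k bound with anySubset? (λ S → P? S ×-dec (∣ S ∣ ≟ k))
  ... | yes attained = k , attained , bound
  descend zero    bound | no none = contradiction (S₀ , PS₀ , n≤0⇒n≡0 (bound S₀ PS₀)) none
  descend (suc k) bound | no none =
    descend k λ S PS → s≤s⁻¹ (≤∧≢⇒< (bound S PS) λ ∣S∣≡ → none (S , PS , ∣S∣≡))

0<∣S∣⇒nonempty : ∀ {n} (S : Subset n) → 0 < ∣ S ∣ → Nonempty S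
0<∣S∣⇒nonempty {n} S 0<∣S∣ with nonempty? S
... | yes nonempty = nonempty
... | no  empty    = contradiction (subst (0 <_) (trans (cong ∣_∣ (Empty-unique empty)) (∣⊥∣≡0 n)) 0<∣S∣) λ ()

∣S∣<n⇒∃∉ : ∀ {n} (S : Subset n) → ∣ S ∣ < n → ∃[ v ] v ∉ S
∣S∣<n⇒∃∉ {n} S ∣S∣<n with Fin.any? (λ v → ¬? (v ∈? S))
... | yes missing = missing
... | no  full    = contradiction ∣S∣<n (≤⇒≯ (subst (_≤ ∣ S ∣) (∣⊤∣≡n n) (p⊆q⇒∣p∣≤∣q∣ ⊤⊆S)))
  where
  ⊤⊆S : ∀ {v} → v ∈ ⊤ → v ∈ S
  ⊤⊆S {v} _ with v ∈? S
  ... | yes v∈S = v∈S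
  ... | no  v∉S = contradiction (v , v∉S) full

module _ {n} (G : Graph n) where

  -- The first step of the path that leaves `S` is such an edge.
  boundary-edge : ∀ (S : Subset n) {u v} → Star (λ x y → T (adj G x y)) u v → u ∈ S → v ∉ S →
    ∃[ x ] ∃[ y ] x ∈ S × y ∉ S × adj G x y ≡ true
  boundary-edge S ε u∈S v∉S = contradiction u∈S v∉S
  boundary-edge S (_◅_ {u} {w} uw path) u∈S v∉S with w ∈? S
  ... | yes w∈S = boundary-edge S path w∈S v∉S
  ... | no  w∉S = u , w , u∈S , w∉S , Equivalence.to T-≡ uw

  degree<n : ∀ v → degree G v < n
  degree<n v = subst (degree G v <_) (∣⊤∣≡n n) (p⊂q⇒∣p∣<∣q∣ (⊆⊤ , v , ∈⊤ , v∉Nv))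
    where
    v∉Nv : v ∉ N G v
    v∉Nv v∈Nv = contradiction (trans (sym (∈-tabulate⁻ v∈Nv)) (irrefl G v)) λ ()

  degreeIn<degree : ∀ S {x y} → y ∉ S → adj G x y ≡ true → degreeIn G S x < degree G x
  degreeIn<degree S {x} {y} y∉S xy =
    p⊂q⇒∣p∣<∣q∣ (p∩q⊆p (N G x) S , y , ∈-tabulate⁺ xy , y∉S ∘ p∩q⊆q (N G x) S)

  degree≤maxDegree : ∀ v → degree G v ≤ maxDegree G
  degree≤maxDegree = ≤foldr-⊔ (degree G)
    where
    ≤foldr-⊔ : ∀ {m} (f : Fin m → ℕ) i → f i ≤ Vector.foldr _⊔_ 0 f
    ≤foldr-⊔ f zero    = m≤m⊔n (f zero) _
    ≤foldr-⊔ f (suc i) = ≤-trans (≤foldr-⊔ (f ∘ suc) i) (m≤n⊔m (f zero) _)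

-- With D = d + 1 and n = n′ + 1, density of a vertex that has a neighbour outside reads
-- D s ≤ d n′; after multiplication by D the claim (s + 1)(D + 1) ≤ n D needs only D ≤ n′.
dense⇒size-bound : ∀ {d n s} → suc d ≤ n → suc d * s ≤ d * n →
  suc s * suc (suc d) ≤ suc n * suc d
dense⇒size-bound {d} {_} {s} d<n dense with e , refl ← m≤n⇒∃[o]m+o≡n d<n =
  *-cancelʳ-≤ _ _ (suc d) (begin
    suc s * suc (suc d) * suc d                             ≡⟨ expand s d ⟩
    (suc d * s + suc d) * suc (suc d)                       ≤⟨ *-monoˡ-≤ (suc (suc d)) (+-monoˡ-≤ (suc d) dense) ⟩
    (d * (suc d + e) + suc d) * suc (suc d)                 ≤⟨ m≤m+n _ e ⟩
    (d * (suc d + e) + suc d) * suc (suc d) + e             ≡⟨ collect d e ⟩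
    suc (suc d + e) * suc d * suc d                         ∎)
  where
  open ≤-Reasoning
  expand : ∀ s d → suc s * suc (suc d) * suc d ≡ (suc d * s + suc d) * suc (suc d)
  expand = solve-∀
  collect : ∀ d e → (d * (suc d + e) + suc d) * suc (suc d) + e ≡ suc (suc d + e) * suc d * suc d
  collect = solve-∀

module _ {n} (G : Graph n) where

  -- A boundary edge supplies a vertex `x` of `S` with an outside neighbour. Density there gives the
  -- bound with the degree of `x` in place of the maximum degree, and `raise` closes the gap.
  IsPDS⇒size-bound : Connected G → ∀ {S} → IsPDS G S → ∣ S ∣ * suc (maxDegree G) ≤ n * maxDegree G
  IsPDS⇒size-bound connected {S} pds =
    let u , u∈S = 0<∣S∣⇒nonempty S (≤-trans (s≤s z≤n) (IsPDS.2≤∣S∣ pds))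
        v , v∉S = ∣S∣<n⇒∃∉ S (IsPDS.∣S∣<n pds)
        x , y , x∈S , y∉S , xy = boundary-edge G S (connected u v) u∈S v∉S
        Δ-d , d+[Δ-d]≡Δ = m≤n⇒∃[o]m+o≡n (degree≤maxDegree G x)
    in subst (λ Δ → ∣ S ∣ * suc Δ ≤ n * Δ) d+[Δ-d]≡Δ
         (raise Δ-d (∣p∣≤n S)
           (bound (IsPDS.2≤∣S∣ pds) (degree<n G x) (degreeIn<degree G S y∉S xy) (IsPDS⇒dense pds x x∈S)))
    where
    open ≤-Reasoning
    bound : ∀ {d d′ n s} → 2 ≤ s → d < n → d′ < d → d * (s ∸ 1) ≤ d′ * (n ∸ 1) → s * suc d ≤ n * d
    bound {suc d} {d′} {suc n} {suc s} _ (s≤s d<n) (s≤s d′≤d) dense =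
      dense⇒size-bound d<n (≤-trans dense (*-monoˡ-≤ n d′≤d))
    -- Raising the degree by `e` adds `s * e` on the left and `n * e` on the right.
    raise : ∀ {d n s} e → s ≤ n → s * suc d ≤ n * d → s * suc (d + e) ≤ n * (d + e)
    raise {d} {n} {s} e s≤n sd≤nd = begin
      s * (suc d + e)    ≡⟨ *-distribˡ-+ s (suc d) e ⟩
      s * suc d + s * e  ≤⟨ +-mono-≤ sd≤nd (*-monoˡ-≤ e s≤n) ⟩
      n * d + n * e      ≡⟨ *-distribˡ-+ n d e ⟨
      n * (d + e)        ∎

-- As an unnormalised fraction the right side computes to numerator `2 (Δ + 1) - 2`, which is `2 Δ`,
-- over denominator `1 * suc Δ`; the rest is cross-multiplication.
/-≤-2-2/1+Δ : ∀ m s Δ .{{_ : NonZero s}} → m * suc Δ ≤ (s + s) * Δ → (+ m / s) ≤ℚ (+ 2 / 1) - (+ 2 / suc Δ)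
/-≤-2-2/1+Δ m (suc s) Δ m≤ = *≤* (subst₂ ℤ._≤_
  (trans (ℤ.pos-* m (suc Δ)) (cong (λ d → + m ℤ.* + suc d) (sym (+-identityʳ Δ))))
  (trans (ℤ.pos-* (Δ + Δ) (suc s)) (cong (ℤ._* + suc s) numerator))
  (ℤ.+≤+ (≤-trans m≤ (≤-reflexive (regroup (suc s) Δ)))))
  where
  regroup : ∀ s Δ → (s + s) * Δ ≡ (Δ + Δ) * s
  regroup = solve-∀
  numerator : + (Δ + Δ) ≡ + 2 ℤ.* + suc Δ ℤ.+ -[1+ 1 ] ℤ.* + 1
  numerator = trans (cong (λ k → + (k ∸ 2)) (2+ Δ)) (sym (ℤ.⊖-≥ {2 * suc Δ} {2} (subst (2 ≤_) (2+ Δ) (s≤s (s≤s z≤n)))))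
    where
    2+ : ∀ Δ → suc (suc (Δ + Δ)) ≡ 2 * suc Δ
    2+ = solve-∀

-- Total-correctness triples with time bounds

record Runs (p : Program) (σ : State) (b : ℕ) (Q : State → Set) : Set where
  constructor runs
  field
    {final} : State
    {time}  : ℕ
    halts   : ⟨ p , σ ⟩⇓⟨ final , time ⟩
    time≤   : time ≤ b
    holds   : Q final

runs-map : ∀ {p σ b} {Q R : State → Set} → (∀ τ → Q τ → R τ) → Runs p σ b Q → Runs p σ b R
runs-map f (runs h t≤ q) = runs h t≤ (f _ q)

runs-skip : ∀ {σ} {Q : State → Set} → Q σ → Runs skip σ 1 Q
runs-skip q = runs skip⇓ ≤-refl q

runs-≔ : ∀ {x e σ} {Q : State → Set} → Q (setVar x (eval e σ) σ) → Runs (x ≔ e) σ (suc (cost e)) Q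
runs-≔ q = runs var⇓ ≤-refl q

runs-⟦⟧≔ : ∀ {a i e σ} {Q : State → Set} → Q (setCell a (eval i σ) (eval e σ) σ) →
  Runs (a ⟦ i ⟧≔ e) σ (suc (cost i + cost e)) Q
runs-⟦⟧≔ q = runs cell⇓ ≤-refl q

-- The postcondition of the first program is a run of the second, so proofs follow the program text
-- and assignments are substituted by computation.
runs-⨾ : ∀ {p q σ a b} {Q : State → Set} → Runs p σ a (λ τ → Runs q τ b Q) → Runs (p ⨾ q) σ (suc (a + b)) Q
runs-⨾ (runs h s≤ (runs h′ t≤ q)) = runs (seq⇓ h h′) (s≤s (+-mono-≤ s≤ t≤)) q

runs-if : ∀ {e p q σ a b} {Q : State → Set} →
  (eval e σ ≢ 0 → Runs p σ a Q) → (eval e σ ≡ 0 → Runs q σ b Q) →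
  Runs (If e Then p Else q) σ (suc (cost e + (a + b))) Q
runs-if {e} {σ = σ} {a} {b} onThen onElse with eval e σ ≟ 0
... | yes e≡0 = let runs h t≤ q = onElse e≡0 in runs (else⇓ e≡0 h) (s≤s (+-monoʳ-≤ (cost e) (≤-trans t≤ (m≤n+m b a)))) q
... | no  e≢0 = let runs h t≤ q = onThen e≢0 in runs (then⇓ e≢0 h) (s≤s (+-monoʳ-≤ (cost e) (≤-trans t≤ (m≤m+n a b)))) q

-- The index of the invariant bounds the passes still to come: every pass lowers it, and at 0 the
-- guard must fail. The guard may fail sooner, so the final index is existential.
runs-while : ∀ {e p b} (I : ℕ → State → Set) →
  (∀ σ → I 0 σ → eval e σ ≡ 0) →
  (∀ m σ → I (suc m) σ → eval e σ ≢ 0 → Runs p σ b (I m)) →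
  ∀ m {σ} → I m σ →
  Runs (While e Do p) σ (suc (cost e) + m * suc (cost e + b)) (λ τ → eval e τ ≡ 0 × ∃[ k ] I k τ)
runs-while {e} {p} {b} I exit step m {σ} inv with eval e σ ≟ 0
... | yes e≡0 = runs (exit⇓ e≡0) (m≤m+n _ _) (e≡0 , m , inv)
runs-while {e} {p} {b} I exit step zero {σ} inv | no e≢0 = contradiction (exit σ inv) e≢0
runs-while {e} {p} {b} I exit step (suc m) {σ} inv | no e≢0 =
  let runs h s≤ inv′ = step m σ inv e≢0
      runs h′ t≤ done = runs-while I exit step m inv′
  in runs (loop⇓ e≢0 h h′)
       (≤-trans (s≤s (+-monoʳ-≤ (cost e) (+-mono-≤ s≤ t≤))) (≤-reflexive (regroup (cost e) b (m * suc (cost e + b))))) done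
  where
  regroup : ∀ c b k → suc (c + (b + (suc c + k))) ≡ suc c + (suc (c + b) + k)
  regroup = solve-∀

update-≡ : ∀ {A : Set} (f : ℕ → A) x {y a} → y ≡ x → (f [ x ↦ a ]) y ≡ a
update-≡ f x {y} {a} y≡x = cong (λ d → if d then a else f y) (dec-true (y ≟ x) y≡x)

update-≢ : ∀ {A : Set} (f : ℕ → A) x {y a} → y ≢ x → (f [ x ↦ a ]) y ≡ f y
update-≢ f x {y} {a} y≢x = cong (λ d → if d then a else f y) (dec-false (y ≟ x) y≢x)

-- The program

matrix member : ℕ
matrix = 0
member = 1

order count choice vertex base other outgoing ingoing : ℕ
order    = 0
count    = 1
choice   = 2
vertex   = 3
base     = 4
other    = 5
outgoing = 6
ingoing  = 7

initialise countRow inspect search complement exchangeChosen algorithm : Program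

initialise =
  -- Truncated subtraction serves as comparison: the guard is nonzero exactly while twice the count
  -- is below the order. The loop thus marks half of the vertices, rounded up.
  While (var order ⊖ (var count ⊕ var count)) Do (
    member ⟦ var count ⟧≔ lit 1 ⨾
    count ≔ lit 1 ⊕ var count)

countRow =
  outgoing ≔ lit 0 ⨾
  ingoing ≔ lit 0 ⨾
  other ≔ var order ⨾
  While (var other) Do (
    other ≔ var other ⊖ lit 1 ⨾
    -- On bits a ∸ b is a ∧ not b.
    outgoing ≔ var outgoing ⊕ (matrix ⟦ var base ⊕ var other ⟧ ⊖ member ⟦ var other ⟧) ⨾
    ingoing ≔ var ingoing ⊕ (matrix ⟦ var base ⊕ var other ⟧ ⊖ (lit 1 ⊖ member ⟦ var other ⟧)))

inspect =
  countRow ⨾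
  If (member ⟦ var vertex ⟧)
  Then (If (((var count ⊕ var count) ⊕ (var outgoing ⊕ var outgoing))
            ⊖ ((lit 1 ⊕ var order) ⊕ (var ingoing ⊕ var ingoing)))
        Then (choice ≔ lit 1 ⊕ var vertex)
        Else skip)
  -- The conditional binds tighter than `⨾`, so the two assignments below are executed for every
  -- vertex.
  Else skip ⨾
  vertex ≔ lit 1 ⊕ var vertex ⨾
  -- `base` is the start of the matrix row, `vertex` times `order`, maintained by addition because
  -- multiplication is not primitive.
  base ≔ var order ⊕ var base

-- Leaves in choice the successor of an improvable vertex, or 0 if there is none.
search =
  choice ≔ lit 0 ⨾
  vertex ≔ lit 0 ⨾
  base ≔ lit 0 ⨾
  While (var order ⊖ var vertex) Do inspect

complement =
  other ≔ var order ⨾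
  While (var other) Do (
    other ≔ var other ⊖ lit 1 ⨾
    member ⟦ var other ⟧≔ lit 1 ⊖ member ⟦ var other ⟧)

exchangeChosen =
  If (var choice)
  -- Clearing the chosen vertex first makes the complementation put it back. The new count is the
  -- one given by `size-exchange`.
  Then (member ⟦ var choice ⊖ lit 1 ⟧≔ lit 0 ⨾
        complement ⨾
        count ≔ (lit 1 ⊕ var order) ⊖ var count)
  Else skip

algorithm =
  initialise ⨾
  -- A nonzero start value forces the first pass; `search` then overwrites it.
  choice ≔ lit 1 ⨾
  While (var choice) Do (search ⨾ exchangeChosen)

-- The bound for a conditional charges both branches.
initialiseTime rowTime inspectTime searchTime exchangeTime algorithmTime : ℕ → ℕ
initialiseTime n = 6 + n * 14
rowTime n = 11 + n * 30
inspectTime n = 12 + (n * 30 + 35)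
searchTime n = 13 + n * (4 + inspectTime n)
exchangeTime n = 14 + (n * 13 + 6 + 1)
algorithmTime n = 7 + (n * 14 + (5 + (n * n + n + 1) * (3 + (searchTime n + exchangeTime n))))

-- Prefix sums and matrix entries

prefixSum : ℕ → (ℕ → ℕ) → ℕ
prefixSum zero    g = 0
prefixSum (suc i) g = g i + prefixSum i g

-- `prefixSum` peels off the last entry, like the loops that count down, whereas `∑` peels off the
-- first; this converts between them.
prefixSum-shift : ∀ i g → prefixSum (suc i) g ≡ g 0 + prefixSum i (g ∘ suc)
prefixSum-shift zero    g = refl
prefixSum-shift (suc i) g = begin
  g (suc i) + prefixSum (suc i) g               ≡⟨ cong (_+_ (g (suc i))) (prefixSum-shift i g) ⟩
  g (suc i) + (g 0 + prefixSum i (g ∘ suc))     ≡⟨ swap (g (suc i)) (g 0) _ ⟩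
  g 0 + prefixSum (suc i) (g ∘ suc)             ∎
  where
  open ≡-Reasoning
  swap : ∀ a b c → a + (b + c) ≡ b + (a + c)
  swap = solve-∀

prefixSum≡∑ : ∀ n g → prefixSum n g ≡ ∑ {n} (g ∘ toℕ)
prefixSum≡∑ zero    g = refl
prefixSum≡∑ (suc n) g = trans (prefixSum-shift n g) (cong (_+_ (g 0)) (prefixSum≡∑ n (g ∘ suc)))

-- The row-major index is `toℕ (combine u w)` up to commuting a product, and `remQuot` inverts
-- `combine`.
adjacencyArray-entry : ∀ {n} (G : Graph n) u w → adjacencyArray G (toℕ u * n + toℕ w) ≡ bit (adj G u w)
adjacencyArray-entry {n} G u w with toℕ u * n + toℕ w <? n * n
... | yes i<n² = cong (λ (x , y) → bit (adj G x y)) (trans (cong (remQuot n) index) (remQuot-combine u w))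
  where
  index : fromℕ< i<n² ≡ combine u w
  index = toℕ-injective (trans (toℕ-fromℕ< i<n²) (sym (trans (toℕ-combine u w) (cong (_+ toℕ w) (*-comm n (toℕ u))))))
... | no i≮n² = contradiction (subst (_< n * n) (trans (toℕ-combine u w) (cong (_+ toℕ w) (*-comm n (toℕ u)))) (toℕ<n (combine u w)))
  i≮n²

-- Correctness of the search and of the exchange

module _ {n} (G : Graph n) where

  Loaded : (Fin n → Bool) → State → Set
  Loaded S σ = variables σ order ≡ n × variables σ count ≡ size S ×
    arrays σ matrix ≡ adjacencyArray G × (∀ v → arrays σ member (toℕ v) ≡ bit (S v))

  outEntry inEntry : (ℕ → ℕ → ℕ) → ℕ → ℕ → ℕ
  outEntry α b j = α matrix (b + j) ∸ α member j
  inEntry  α b j = α matrix (b + j) ∸ (1 ∸ α member j)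

  module _ (α : ℕ → ℕ → ℕ) (s g k b : ℕ) where

    -- What counting a row leaves untouched: everything except `other`, `outgoing` and `ingoing`.
    Frame : State → Set
    Frame σ = variables σ order ≡ n × variables σ count ≡ s × variables σ choice ≡ g ×
      variables σ vertex ≡ k × variables σ base ≡ b × arrays σ ≡ α

    countRow-runs : ∀ {σ} → Frame σ → Runs countRow σ (rowTime n) (λ τ →
      Frame τ × variables τ outgoing ≡ prefixSum n (outEntry α b) × variables τ ingoing ≡ prefixSum n (inEntry α b))
    countRow-runs {σ} frame@(refl , _) = runs-⨾ $ runs-≔ $ runs-⨾ $ runs-≔ $ runs-⨾ $ runs-≔ $
      runs-map finish (runs-while I (λ _ → proj₁) step n (refl , frame , refl , refl))
      where
      -- The entries already accumulated and the `i` still pending always add up to the full row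
      -- sum.
      I : ℕ → State → Set
      I i τ = variables τ other ≡ i × Frame τ ×
        variables τ outgoing + prefixSum i (outEntry α b) ≡ prefixSum n (outEntry α b) ×
        variables τ ingoing + prefixSum i (inEntry α b) ≡ prefixSum n (inEntry α b)
      finish : ∀ τ → variables τ other ≡ 0 × (∃[ i ] I i τ) →
        Frame τ × variables τ outgoing ≡ prefixSum n (outEntry α b) × variables τ ingoing ≡ prefixSum n (inEntry α b)
      finish τ (≡0 , i , ≡i , fr , out , in′) with refl ← trans (sym ≡0) ≡i =
        fr , trans (sym (+-identityʳ _)) out , trans (sym (+-identityʳ _)) in′
      -- The values read from the state are generalised to variables here, so that they can be
      -- matched with `refl` and `j ∸ 1` reduces to `i`.
      add : ∀ {j i} x rest {total} (h : (ℕ → ℕ → ℕ) → ℕ → ℕ → ℕ) {β c} → β ≡ α → c ≡ b → j ≡ suc i →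
        x + (h α b i + rest) ≡ total → x + h β c (j ∸ 1) + rest ≡ total
      add x rest h refl refl refl eq = trans (+-assoc x _ _) eq
      step : ∀ i τ → I (suc i) τ → variables τ other ≢ 0 → Runs _ τ 28 (I i)
      step i τ (≡i , fr@(_ , _ , _ , _ , ≡b , ≡α) , out , in′) _ =
        runs-⨾ $ runs-≔ $ runs-⨾ $ runs-≔ $ runs-≔ $
          cong (_∸ 1) ≡i , fr ,
          add (variables τ outgoing) (prefixSum i (outEntry α b))
            (λ β c j → β matrix (c + j) ∸ β member j) ≡α ≡b ≡i out ,
          add (variables τ ingoing) (prefixSum i (inEntry α b))
            (λ β c j → β matrix (c + j) ∸ (1 ∸ β member j)) ≡α ≡b ≡i in′

  module _ (S : Fin n → Bool) where

    -- The second alternative does not mention `k`, so a vertex once found stays valid for all later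
    -- positions.
    Scanned : ℕ → ℕ → Set
    Scanned g k =
      (g ≡ 0 × (∀ w → toℕ w < k → S w ≡ true → ¬ Improvable G S w)) ⊎
      (∃[ w ] g ≡ suc (toℕ w) × S w ≡ true × Improvable G S w)

    scanned-keep : ∀ {g u} → (S u ≡ true → ¬ Improvable G S u) → Scanned g (toℕ u) → Scanned g (suc (toℕ u))
    scanned-keep stuck (inj₂ found) = inj₂ found
    scanned-keep {u = u} stuck (inj₁ (g≡0 , below)) = inj₁ (g≡0 , atMost)
      where
      atMost : ∀ w → toℕ w < suc (toℕ u) → S w ≡ true → ¬ Improvable G S w
      atMost w w≤u with toℕ w ≟ toℕ u
      ... | yes w≡u with refl ← toℕ-injective w≡u = stuck
      ... | no  w≢u = below w (≤∧≢⇒< (s≤s⁻¹ w≤u) w≢u)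

    module _ {α : ℕ → ℕ → ℕ} (α-matrix : α matrix ≡ adjacencyArray G)
             (α-member : ∀ v → α member (toℕ v) ≡ bit (S v)) where

      outEntries : ∀ u → prefixSum n (outEntry α (toℕ u * n)) ≡ outer G S u
      outEntries u = trans (prefixSum≡∑ n _) (∑-cong λ w → trans
        (cong₂ _∸_ (trans (cong (λ A → A (toℕ u * n + toℕ w)) α-matrix) (adjacencyArray-entry G u w)) (α-member w))
        (bits (adj G u w) (S w)))
        where
        bits : ∀ a b → bit a ∸ bit b ≡ bit (a ∧ not b)
        bits true  true  = refl
        bits true  false = refl
        bits false true  = refl
        bits false false = refl

      inEntries : ∀ u → prefixSum n (inEntry α (toℕ u * n)) ≡ inner G S u
      inEntries u = trans (prefixSum≡∑ n _) (∑-cong λ w → trans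
        (cong₂ (λ a b → a ∸ (1 ∸ b))
          (trans (cong (λ A → A (toℕ u * n + toℕ w)) α-matrix) (adjacencyArray-entry G u w)) (α-member w))
        (bits (adj G u w) (S w)))
        where
        bits : ∀ a b → bit a ∸ (1 ∸ bit b) ≡ bit (a ∧ b)
        bits true  true  = refl
        bits true  false = refl
        bits false true  = refl
        bits false false = refl

      inspect-runs : ∀ {g σ} u → Frame α (size S) g (toℕ u) (toℕ u * n) σ → Scanned g (toℕ u) →
        Runs inspect σ (inspectTime n) (λ τ →
          ∃[ g′ ] Frame α (size S) g′ (suc (toℕ u)) (suc (toℕ u) * n) τ × Scanned g′ (suc (toℕ u)))
      inspect-runs {g} u frame scanned = runs-⨾ (runs-map afterRow (countRow-runs α (size S) g (toℕ u) (toℕ u * n) frame))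
        where
        Goal : State → Set
        Goal τ = ∃[ g′ ] Frame α (size S) g′ (suc (toℕ u)) (suc (toℕ u) * n) τ × Scanned g′ (suc (toℕ u))
        Decided : State → Set
        Decided τ = ∃[ g′ ] Frame α (size S) g′ (toℕ u) (toℕ u * n) τ × Scanned g′ (suc (toℕ u))
        advance : ∀ τ → Decided τ → Runs (vertex ≔ lit 1 ⊕ var vertex ⨾ base ≔ var order ⊕ var base) τ 9 Goal
        advance τ (g′ , (≡n , ≡s , ≡g , ≡u , ≡b , ≡α) , scanned′) = runs-⨾ $ runs-≔ $ runs-≔ $
          g′ , (≡n , ≡s , ≡g , cong suc ≡u , cong₂ _+_ ≡n ≡b , ≡α) , scanned′
        afterRow : ∀ τ →
          (Frame α (size S) g (toℕ u) (toℕ u * n) τ ×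
           variables τ outgoing ≡ prefixSum n (outEntry α (toℕ u * n)) ×
           variables τ ingoing ≡ prefixSum n (inEntry α (toℕ u * n))) →
          Runs _ τ 35 Goal
        afterRow τ (fr@(≡n , ≡s , ≡g , ≡u , ≡b , ≡α) , out , in′) = runs-⨾ $ runs-map advance $ runs-if
          (λ u∈S → runs-if
            (λ gain → runs-≔ (suc (toℕ u) , (≡n , ≡s , cong suc ≡u , ≡u , ≡b , ≡α) ,
              inj₂ (u , refl , selected (u∈S ∘ trans memberBit) , m∸n≢0⇒n<m (gain ∘ trans difference))))
            (λ noGain → runs-skip (g , fr , scanned-keep
              (λ _ → ≤⇒≯ (m∸n≡0⇒m≤n (trans (sym difference) noGain))) scanned)))
          (λ u∉S → runs-skip (g , fr , scanned-keep
            (λ Su → contradiction (trans (sym (cong bit Su)) (trans (sym memberBit) u∉S)) λ ()) scanned))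
          where
          memberBit : arrays τ member (variables τ vertex) ≡ bit (S u)
          memberBit = trans (cong₂ (λ β k → β member k) ≡α ≡u) (α-member u)
          selected : ∀ {b} → bit b ≢ 0 → b ≡ true
          selected {true}  _   = refl
          selected {false} 0≢0 = contradiction refl 0≢0
          -- The left side is the value of the inner guard; the right side is nonzero exactly when
          -- `u` satisfies the inequality of `Improvable`.
          difference :
            (variables τ count + variables τ count + (variables τ outgoing + variables τ outgoing)) ∸
            suc (variables τ order + (variables τ ingoing + variables τ ingoing)) ≡
            (size S + size S + (outer G S u + outer G S u)) ∸ (suc n + (inner G S u + inner G S u))
          difference rewrite ≡n | ≡s | trans out (outEntries u) | trans in′ (inEntries u) = refl

  search-runs : ∀ {S σ} → Loaded S σ → Runs search σ (searchTime n) (λ τ →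
    Loaded S τ × Scanned S (variables τ choice) n)
  search-runs {S} {σ} (≡n , ≡s , ≡A , ≡S) = runs-⨾ $ runs-≔ $ runs-⨾ $ runs-≔ $ runs-⨾ $ runs-≔ $
    runs-map finish (runs-while I exit step n
      (0 , 0 , refl , (≡n , ≡s , refl , refl , refl , refl) , inj₁ (refl , λ w ())))
    where
    α = arrays σ
    I : ℕ → State → Set
    I m τ = ∃[ g ] ∃[ k ] k + m ≡ n × Frame α (size S) g k (k * n) τ × Scanned S g k
    exit : ∀ τ → I 0 τ → variables τ order ∸ variables τ vertex ≡ 0
    exit τ (g , k , k≡n , (≡n , _ , _ , ≡k , _) , _) =
      trans (cong₂ _∸_ ≡n ≡k) (m≤n⇒m∸n≡0 (≤-reflexive (trans (sym k≡n) (+-identityʳ k))))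
    room : ∀ {k m} → k + suc m ≡ n → k < n
    room {k} {m} k+m≡n = ≤-trans (m≤m+n (suc k) m) (≤-reflexive (trans (sym (+-suc k m)) k+m≡n))
    step : ∀ m τ → I (suc m) τ → variables τ order ∸ variables τ vertex ≢ 0 → Runs inspect τ (inspectTime n) (I m)
    step m τ (g , k , k+m≡n , frame , scanned) _
      -- A counter below `n` is replaced by the vertex it names, the form `inspect-runs` expects.
      with u , refl ← (Σ (Fin n) λ u → k ≡ toℕ u) ∋ (fromℕ< (room k+m≡n) , sym (toℕ-fromℕ< (room k+m≡n))) =
      runs-map (λ υ (g′ , frame′ , scanned′) → g′ , suc (toℕ u) , trans (sym (+-suc (toℕ u) m)) k+m≡n , frame′ , scanned′)
        (inspect-runs S ≡A ≡S u frame scanned)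
    finish : ∀ τ → variables τ order ∸ variables τ vertex ≡ 0 × (∃[ m ] I m τ) →
      Loaded S τ × Scanned S (variables τ choice) n
    finish τ (done , m , g , k , k+m≡n , (≡n , ≡s , ≡g , ≡k , _ , ≡α) , scanned) =
      (≡n , ≡s , trans (cong (λ β → β matrix) ≡α) ≡A , λ v → trans (cong (λ β → β member (toℕ v)) ≡α) (≡S v)) ,
      subst₂ (Scanned S) (sym ≡g)
        (≤-antisym (m+n≤o⇒m≤o k (≤-reflexive k+m≡n)) (m∸n≡0⇒m≤n (trans (sym (cong₂ _∸_ ≡n ≡k)) done)))
        scanned

  exchange-runs : ∀ {S σ} u → Loaded S σ → variables σ choice ≡ suc (toℕ u) → S u ≡ true →
    Runs exchangeChosen σ (exchangeTime n) (λ τ → Loaded (exchange S u) τ × variables τ choice ≡ suc (toℕ u))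
  exchange-runs {S} {σ} u (≡n , ≡s , ≡A , ≡S) ≡u u∈S = runs-if
    (λ _ → runs-⨾ $ runs-⟦⟧≔ $ runs-⨾ $ runs-⨾ $ runs-≔ $
      runs-map finish (runs-while I (λ _ → proj₁) step n (≡n , (≡n , ≡s , ≡u , ≡A) , start)))
    (λ none → contradiction (trans (sym ≡u) none) λ ())
    where
    S′ = exchange S u
    B₀ = arrays σ member [ variables σ choice ∸ 1 ↦ 0 ]
    -- Once `u` is cleared the array holds exactly the complement of `S′`. The loop runs downwards,
    -- so positions from `i` on are already flipped to `S′`.
    Partly : ℕ → (ℕ → ℕ) → Set
    Partly i B = ∀ v → (toℕ v < i → B (toℕ v) ≡ bit (not (S′ v))) × (i ≤ toℕ v → B (toℕ v) ≡ bit (S′ v))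
    I : ℕ → State → Set
    I i τ = variables τ other ≡ i ×
      (variables τ order ≡ n × variables τ count ≡ size S × variables τ choice ≡ suc (toℕ u) ×
       arrays τ matrix ≡ adjacencyArray G) ×
      Partly i (arrays τ member)
    start : Partly n B₀
    start v = (λ _ → cleared v) , λ n≤v → contradiction (toℕ<n v) (≤⇒≯ n≤v)
      where
      cleared : ∀ v → B₀ (toℕ v) ≡ bit (not (S′ v))
      cleared v with v Fin.≟ u
      ... | yes refl = update-≡ (arrays σ member) _ (sym (cong (_∸ 1) ≡u))
      ... | no  v≢u  = trans
        (update-≢ (arrays σ member) _ (λ v≡ → v≢u (toℕ-injective (trans v≡ (cong (_∸ 1) ≡u)))))
        (trans (≡S v) (cong bit (sym (not-involutive (S v)))))
    1∸bit : ∀ b → 1 ∸ bit (not b) ≡ bit b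
    1∸bit true  = refl
    1∸bit false = refl
    toggle : ∀ {i j B} → j ≡ suc i → Partly (suc i) B → Partly i (B [ j ∸ 1 ↦ 1 ∸ B (j ∸ 1) ])
    toggle {i} {B = B} refl partly v =
      (λ v<i → trans (update-≢ B i (<⇒≢ v<i)) (proj₁ (partly v) (m≤n⇒m≤1+n v<i))) , reached
      where
      reached : i ≤ toℕ v → (B [ i ↦ 1 ∸ B i ]) (toℕ v) ≡ bit (S′ v)
      reached i≤v with toℕ v ≟ i
      ... | yes refl = trans (update-≡ B (toℕ v) refl) (trans (cong (1 ∸_) (proj₁ (partly v) ≤-refl)) (1∸bit (S′ v)))
      ... | no  v≢i  = trans (update-≢ B i v≢i) $ proj₂ (partly v) (≤∧≢⇒< i≤v (v≢i ∘ sym))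
    step : ∀ i τ → I (suc i) τ → variables τ other ≢ 0 → Runs _ τ 11 (I i)
    step i τ (≡i , frame , partly) _ = runs-⨾ $ runs-≔ $ runs-⟦⟧≔ $
      cong (_∸ 1) ≡i , frame , toggle {B = arrays τ member} ≡i partly
    finish : ∀ τ → variables τ other ≡ 0 × (∃[ i ] I i τ) →
      Runs (count ≔ (lit 1 ⊕ var order) ⊖ var count) τ 6
        (λ υ → Loaded S′ υ × variables υ choice ≡ suc (toℕ u))
    finish τ (≡0 , i , ≡i , (≡n , ≡s , ≡u , ≡A) , partly) with refl ← trans (sym ≡0) ≡i = runs-≔ $
      (≡n , newCount , ≡A , λ v → proj₂ (partly v) z≤n) , ≡u
      where
      newCount : suc (variables τ order) ∸ variables τ count ≡ size S′
      newCount rewrite ≡n | ≡s = trans (cong (_∸ size S) (sym (size-exchange S u u∈S))) (m+n∸n≡m (size S′) (size S))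

-- The initial balanced set

below : ∀ {n} → ℕ → Fin n → Bool
below c v = toℕ v <ᵇ c

size-below : ∀ {n c} → c ≤ n → size (below {n} c) ≡ c
size-below {zero}  {zero}  _         = refl
size-below {suc n} {zero}  _         = size-below {n} {zero} z≤n
size-below {suc n} {suc c} (s≤s c≤n) = cong suc (size-below c≤n)

<ᵇ-suc-≢ : ∀ {j c} → j ≢ c → (j <ᵇ suc c) ≡ (j <ᵇ c)
<ᵇ-suc-≢ {zero}  {zero}  0≢0 = contradiction refl 0≢0
<ᵇ-suc-≢ {zero}  {suc c} _   = refl
<ᵇ-suc-≢ {suc j} {zero}  _   = refl
<ᵇ-suc-≢ {suc j} {suc c} j≢c = <ᵇ-suc-≢ (j≢c ∘ cong suc)

n<ᵇ1+n : ∀ n → (n <ᵇ suc n) ≡ true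
n<ᵇ1+n zero    = refl
n<ᵇ1+n (suc n) = n<ᵇ1+n n

module _ {n} (G : Graph n) where

  initialise-runs : Runs initialise (input G) (initialiseTime n) (λ τ →
    ∃[ S ] Loaded G S τ × Balanced S)
  initialise-runs = runs-map finish (runs-while I exit step n (refl , refl , m∸n≤m n 0 , z≤n , λ j → refl))
    where
    -- The value of the guard bounds the remaining passes. A pass starts with `2 c < n` and so ends
    -- with twice the new count at most `n + 1`.
    I : ℕ → State → Set
    I m τ = variables τ order ≡ n × arrays τ matrix ≡ adjacencyArray G ×
      n ∸ (variables τ count + variables τ count) ≤ m ×
      variables τ count + variables τ count ≤ suc n ×
      (∀ j → arrays τ member j ≡ bit (j <ᵇ variables τ count))
    exit : ∀ τ → I 0 τ → variables τ order ∸ (variables τ count + variables τ count) ≡ 0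
    exit τ (refl , _ , ≤0 , _) = n≤0⇒n≡0 ≤0
    step : ∀ m τ → I (suc m) τ → variables τ order ∸ (variables τ count + variables τ count) ≢ 0 → Runs _ τ 8 (I m)
    step m τ (≡n , ≡A , ≤1+m , _ , ≡S) unfilled = runs-⨾ $ runs-⟦⟧≔ $ runs-≔ $
      ≡n , ≡A ,
      -- Twice the count grows by two, of which one is enough to lower the bound from `suc m` to
      -- `m`.
      ≤-trans (∸-monoʳ-≤ n (s≤s (+-monoʳ-≤ c (n≤1+n c))))
        (subst (_≤ m) (pred[m∸n]≡m∸[1+n] n (c + c)) (pred-mono-≤ ≤1+m)) ,
      subst (_≤ suc n) (cong suc (sym (+-suc c c))) (s≤s 2c<n) ,
      mark
      where
      c = variables τ count
      2c<n : c + c < n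
      2c<n = subst (c + c <_) ≡n (m∸n≢0⇒n<m unfilled)
      mark : ∀ j → (arrays τ member [ c ↦ 1 ]) j ≡ bit (j <ᵇ suc c)
      mark j with j ≟ c
      ... | yes refl = trans (update-≡ (arrays τ member) j refl) (cong bit (sym (n<ᵇ1+n j)))
      ... | no  j≢c  = trans (update-≢ (arrays τ member) c j≢c) $ trans (≡S j) (cong bit (sym (<ᵇ-suc-≢ j≢c)))
    finish : ∀ τ → variables τ order ∸ (variables τ count + variables τ count) ≡ 0 × (∃[ m ] I m τ) →
      ∃[ S ] Loaded G S τ × Balanced S
    finish τ (done , m , ≡n , ≡A , _ , 2c≤1+n , ≡S) =
      below c , (≡n , sym size≡c , ≡A , λ v → ≡S (toℕ v)) ,
      subst (λ s → n ≤ s + s × s + s ≤ suc (suc n)) (sym size≡c)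
        (subst (_≤ c + c) ≡n (m∸n≡0⇒m≤n done) , m≤n⇒m≤1+n 2c≤1+n)
      where
      c = variables τ count
      size≡c : size (below {n} c) ≡ c
      size≡c = size-below (m+m≤1+n+n⇒m≤n {n = n} (≤-trans 2c≤1+n (s≤s (m≤m+n n n))))

  -- Termination and correctness of the local search

  Solved : State → Set
  Solved τ = ∃[ S ] (∀ v → arrays τ member (toℕ v) ≡ bit (S v)) × Balanced S ×
    (∀ u → S u ≡ true → ¬ Improvable G S u)

  algorithm-runs : Runs algorithm (input G) (algorithmTime n) Solved
  algorithm-runs = runs-⨾ (runs-map improve initialise-runs)
    where
    -- The potential is the variant, bounded by `m` only while `choice` is nonzero: the last pass
    -- makes no exchange, sets `choice` to 0 and certifies local optimality instead.
    I : ℕ → State → Set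
    I m τ = ∃[ S ] Loaded G S τ × Balanced S ×
      (variables τ choice ≡ 0 → ∀ u → S u ≡ true → ¬ Improvable G S u) ×
      (variables τ choice ≢ 0 → potential G S < m)
    exit : ∀ τ → I 0 τ → variables τ choice ≡ 0
    exit τ (_ , _ , _ , _ , bound) with variables τ choice ≟ 0
    ... | yes ≡0 = ≡0
    ... | no  ≢0 = contradiction (bound ≢0) λ ()
    step : ∀ m τ → I (suc m) τ → variables τ choice ≢ 0 →
      Runs (search ⨾ exchangeChosen) τ (suc (searchTime n + exchangeTime n)) (I m)
    step m τ (S , loaded , balanced , _ , bound) ≢0 = runs-⨾ (runs-map react (search-runs G loaded))
      where
      react : ∀ υ → Loaded G S υ × Scanned G S (variables υ choice) n → Runs exchangeChosen υ (exchangeTime n) (I m)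
      -- The impossible branch fixes no time, so the cost of a real exchange is supplied to match
      -- `exchangeTime`.
      react υ (loaded′ , inj₁ (≡0 , stuck)) = runs-if {a = 12 + (n * 13 + 6)}
        (λ ≢0 → contradiction ≡0 ≢0)
        (λ _ → runs-skip (S , loaded′ , balanced , (λ _ u → stuck u (toℕ<n u)) , λ ≢0 → contradiction ≡0 ≢0))
      react υ (loaded′ , inj₂ (u , ≡u , u∈S , improvable)) = runs-map
        (λ ω (loaded″ , ≡u′) → exchange S u , loaded″ , balanced-exchange S u u∈S balanced ,
          (λ ≡0 → contradiction (trans (sym ≡u′) ≡0) λ ()) ,
          (λ _ → ≤-trans (potential-exchange G S u u∈S improvable) (s≤s⁻¹ (bound ≢0))))
        (exchange-runs G u loaded′ ≡u u∈S)
    improve : ∀ τ → ∃[ S ] Loaded G S τ × Balanced S → Runs _ τ _ Solved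
    improve τ (S , loaded , balanced) = runs-⨾ $ runs-≔ $
      runs-map (λ υ (≡0 , m , S , (_ , _ , _ , ≡S) , balanced , stuck , _) → S , ≡S , balanced , stuck ≡0)
        -- The potential is at most `n * n + n`, and the invariant asks for a strict bound.
        (runs-while I exit step (n * n + n + 1)
          (S , loaded , balanced , (λ ()) , λ _ → ≤-trans (s≤s (potential≤ G S)) (≤-reflexive (+-comm 1 (n * n + n)))))

-- Polynomial time bounds

PolynomiallyBounded : (ℕ → ℕ) → Set
PolynomiallyBounded f = ∃[ c ] ∃[ k ] ∀ n → 1 ≤ n → f n ≤ c * n ^ k

constant : ∀ c → PolynomiallyBounded (λ _ → c)
constant c = c , 0 , λ n _ → ≤-reflexive (sym (*-identityʳ c))

identity : PolynomiallyBounded (λ n → n)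
identity = 1 , 1 , λ n _ → ≤-reflexive (sym (trans (*-identityˡ (n * 1)) (*-identityʳ n)))

infixl 6 _⟨+⟩_
infixl 7 _⟨*⟩_

-- For `1 ≤ n` powers grow with the exponent, so `j + k` serves as a common exponent for both
-- summands.
_⟨+⟩_ : ∀ {f g} → PolynomiallyBounded f → PolynomiallyBounded g → PolynomiallyBounded (λ n → f n + g n)
(c , j , f≤) ⟨+⟩ (d , k , g≤) = c + d , j + k , λ n 1≤n →
  ≤-trans (+-mono-≤
      (≤-trans (f≤ n 1≤n) (*-monoʳ-≤ c (^-monoʳ-≤ n {{>-nonZero 1≤n}} (m≤m+n j k))))
      (≤-trans (g≤ n 1≤n) (*-monoʳ-≤ d (^-monoʳ-≤ n {{>-nonZero 1≤n}} (m≤n+m k j)))))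
    (≤-reflexive (sym (*-distribʳ-+ (n ^ (j + k)) c d)))

_⟨*⟩_ : ∀ {f g} → PolynomiallyBounded f → PolynomiallyBounded g → PolynomiallyBounded (λ n → f n * g n)
(c , j , f≤) ⟨*⟩ (d , k , g≤) = c * d , j + k , λ n 1≤n →
  ≤-trans (*-mono-≤ (f≤ n 1≤n) (g≤ n 1≤n))
    (≤-reflexive (trans (interchange c (n ^ j) d (n ^ k)) (cong (c * d *_) (sym (^-distribˡ-+-* n j k)))))
  where
  interchange : ∀ c x d y → c * x * (d * y) ≡ c * d * (x * y)
  interchange = solve-∀

algorithmTime-polynomial : PolynomiallyBounded algorithmTime
algorithmTime-polynomial =
  constant 7 ⟨+⟩ (identity ⟨*⟩ constant 14 ⟨+⟩ (constant 5 ⟨+⟩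
    (identity ⟨*⟩ identity ⟨+⟩ identity ⟨+⟩ constant 1) ⟨*⟩
      (constant 3 ⟨+⟩ (searchTime-polynomial ⟨+⟩ exchangeTime-polynomial))))
  where
  searchTime-polynomial : PolynomiallyBounded searchTime
  searchTime-polynomial =
    -- The 16 is the 4 in `searchTime` plus the leading 12 of `inspectTime`, merged by computation.
    constant 13 ⟨+⟩ identity ⟨*⟩ (constant 16 ⟨+⟩ (identity ⟨*⟩ constant 30 ⟨+⟩ constant 35))
  exchangeTime-polynomial : PolynomiallyBounded exchangeTime
  exchangeTime-polynomial = constant 14 ⟨+⟩ (identity ⟨*⟩ constant 13 ⟨+⟩ constant 6 ⟨+⟩ constant 1)

proposition2 :
    ∃[ algorithm ] ∃[ c ] ∃[ k ]
      ∀ {n} (G : Graph n) → Connected G → 3 ≤ n →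
        ∃[ σ ] ∃[ t ]
          ⟨ algorithm , input G ⟩⇓⟨ σ , t ⟩ ×
          t ≤ c * n ^ k ×
          Σ[ pds ∈ IsPDS G (output n σ) ]
          ∃[ opt ] IsOpt G opt ×
            performanceRatio opt pds ≤ℚ (+ 2 / 1) - (+ 2 / suc (maxDegree G))
proposition2 =
  let c , k , time≤cnᵏ = algorithmTime-polynomial
  in algorithm , c , k , λ {n} G connected 3≤n →
    let runs {σ} {t} halts t≤ (S , ≡S , balanced , stuck) = algorithm-runs G
        output≡S = tabulate-cong λ v → trans (cong (λ b → does (0 <? b)) (≡S v)) (positive-bit (S v))
        pds = subst (IsPDS G) (sym output≡S) (stuck⇒IsPDS 3≤n balanced stuck)
        -- The output is itself a PDS, which guarantees that a maximum exists.
        m , (T , T-pds , ∣T∣≡m) , maximal = maximum-size isPDS? (output n σ , pds)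
        n≤2∣output∣ = subst (λ s → n ≤ s + s) (sym (trans (cong ∣_∣ output≡S) (∣tabulate∣ S))) (proj₁ balanced)
    in σ , t , halts , ≤-trans t≤ (time≤cnᵏ n (≤-trans (s≤s z≤n) 3≤n)) , pds , m , ((T , T-pds , ∣T∣≡m) , maximal) ,
       /-≤-2-2/1+Δ m ∣ output n σ ∣ (maxDegree G) {{IsPDS.∣S∣-nonZero pds}}
         (≤-trans (subst (λ s → s * suc (maxDegree G) ≤ n * maxDegree G) ∣T∣≡m (IsPDS⇒size-bound G connected T-pds))
           (*-monoˡ-≤ (maxDegree G) n≤2∣output∣))
  where
  positive-bit : ∀ b → does (0 <? bit b) ≡ b
  positive-bit true  = refl
  positive-bit false = refl
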